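{- Let $G$ be an edge-coloured graph. The following statements are equivalent: (a) $G$ is vertex-monochromatic. (b) Every (connected) component of $G$ is edge-monochromatic. (c) $G$ has no alternating path with at least two edges. (d) $G$ has no conflict pair.
   Context: An edge-coloured graph $G$ is a finite simple undirected graph in which each edge $e$ has a unique colour $\psi(e)\in\{1,\dots,t\}$ for some positive integer $t$ (the edge colouring is arbitrary, not required to be proper). A vertex is colourful if its incident edges have at least two different colours, and monochromatic otherwise (so an isolated vertex is monochromatic). A graph is vertex-monochromatic if all its vertices are monochromatic vertices of that graph. A graph is edge-monochromatic if all its edges have the same colour (vacuously true if it has no edges). A conflict pair is a pair of adjacent edges (two distinct edges sharing an end) of different colours. An alternating path is a simple path in which every pair of consecutive edges forms a conflict pair. -}

module Defs where

open import Data.Fin using (Fin)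
open import Data.Fin.Subset using (Subset; _∈_; _⊆_; Nonempty)
open import Data.List using (List; []; _∷_; length)
open import Data.List.Relation.Unary.Linked using (Linked)
open import Data.List.Relation.Unary.Unique.Propositional using (Unique)
open import Data.Nat using (ℕ)
open import Data.Product using (_×_; _,_; ∃-syntax)
open import Data.Sum using (_⊎_)
open import Level using (0ℓ)
open import Relation.Binary.Core using (Rel)
open import Relation.Binary.Definitions using (Symmetric; Decidable)
open import Relation.Binary.Construct.Closure.ReflexiveTransitive using (Star; ε; _◅_)
open import Relation.Binary.PropositionalEquality using (_≡_; _≢_)
open import Relation.Nullary using (¬_)

-- The vertices form an arbitrary subset V of an ambient finite set Fin N
-- (rather than all of Fin N), so that a subgraph of a graph, in particular a
-- connected component, is again a graph over the same ambient set.
record SimpleGraph (N : ℕ) : Set₁ where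
  field
    V        : Subset N
    Adj      : Rel (Fin N) 0ℓ
    adj?     : Decidable Adj
    adj-V    : ∀ {u v} → Adj u v → u ∈ V × v ∈ V
    adj-sym  : Symmetric Adj
    adj-irr  : ∀ {v} → ¬ Adj v v

  -- An edge is given by an ordered pair of adjacent vertices; the undirected
  -- edges of the graph are the elements of Edge up to _≈ᴱ_.
  record Edge : Set where
    constructor edge
    field
      {source target} : Fin N
      adjacent        : Adj source target

  open Edge public

  _≈ᴱ_ : Rel Edge 0ℓ
  e ≈ᴱ f = (source e ≡ source f × target e ≡ target f)
         ⊎ (source e ≡ target f × target e ≡ source f)

  _IsEndOf_ : Fin N → Edge → Set
  v IsEndOf e = v ≡ source e ⊎ v ≡ target e

  AdjacentEdges : Rel Edge 0ℓ
  AdjacentEdges e f = ¬ (e ≈ᴱ f) × ∃[ v ] (v IsEndOf e × v IsEndOf f)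

  Walk : Rel (Fin N) 0ℓ
  Walk = Star Adj

  vertices : ∀ {u v} → Walk u v → List (Fin N)
  vertices {u} ε       = u ∷ []
  vertices {u} (_ ◅ w) = u ∷ vertices w

  edges : ∀ {u v} → Walk u v → List Edge
  edges ε       = []
  edges (a ◅ w) = edge a ∷ edges w

  Connected : Set
  Connected = Nonempty V × (∀ {u v} → u ∈ V → v ∈ V → Walk u v)

record EdgeColouredGraph (N t : ℕ) : Set₁ where
  field
    simpleGraph : SimpleGraph N

  open SimpleGraph simpleGraph public

  -- ψ-cong makes the colour a function of the undirected edge.
  field
    ψ      : Edge → Fin t
    ψ-cong : ∀ {e f} → e ≈ᴱ f → ψ e ≡ ψ f

  Colourful : Fin N → Set
  Colourful v = ∃[ e ] ∃[ f ] (v IsEndOf e × v IsEndOf f × ψ e ≢ ψ f)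

  Monochromatic : Fin N → Set
  Monochromatic v = ¬ Colourful v

  VertexMonochromatic : Set
  VertexMonochromatic = ∀ {v} → v ∈ V → Monochromatic v

  EdgeMonochromatic : Set
  EdgeMonochromatic = ∀ (e f : Edge) → ψ e ≡ ψ f

  ConflictPair : Rel Edge 0ℓ
  ConflictPair e f = AdjacentEdges e f × ψ e ≢ ψ f

  record AlternatingPath : Set where
    field
      {start end} : Fin N
      -- Only excludes the trivial walk at an element of Fin N outside V.
      start∈V     : start ∈ V
      walk        : Walk start end
      simple      : Unique (vertices walk)
      alternating : Linked ConflictPair (edges walk)

    size : ℕ
    size = length (edges walk)

module _ {N t : ℕ} where

  record _⊑_ (H G : EdgeColouredGraph N t) : Set where
    private
      module H = EdgeColouredGraph H
      module G = EdgeColouredGraph G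
    field
      V-⊆     : H.V ⊆ G.V
      Adj-⊆   : ∀ {u v} → H.Adj u v → G.Adj u v
      ψ-agree : ∀ {u v} (a : H.Adj u v) → H.ψ (H.edge a) ≡ G.ψ (G.edge (Adj-⊆ a))

  -- The components of G are its maximal connected subgraphs.
  record _IsComponentOf_ (H G : EdgeColouredGraph N t) : Set₁ where
    field
      subgraph  : H ⊑ G
      connected : EdgeColouredGraph.Connected H
      maximal   : ∀ (K : EdgeColouredGraph N t) → K ⊑ G →
                  EdgeColouredGraph.Connected K → H ⊑ K → K ⊑ H

{-# OPTIONS --safe #-}

-- Two edges of different colours at a common vertex are automatically distinct,
-- and form a path with two edges, so (a), (c) and (d) all forbid the same
-- configuration.  Without such a pair the colour is constant along every walk, which
-- gives (b).  For (b) ⇒ (d), a conflict pair lies in the component of its common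
-- vertex.  That component needs its vertex set as a Subset, hence a decision of
-- reachability; as (d) is a negation, excluded middle under a double negation
-- supplies it.
module Submission where

open import Defs
open import Data.Bool using (true)
open import Data.Fin using (Fin)
open import Data.Fin.Properties using (_≟_; sequence)
open import Data.Fin.Subset using (Subset; _∈_)
open import Data.Fin.Subset.Properties using (_∈?_)
open import Data.List.Relation.Unary.All using ([]; _∷_)
open import Data.List.Relation.Unary.AllPairs using ([]; _∷_)
open import Data.List.Relation.Unary.Linked using ([-]; _∷_)
open import Data.Nat using (ℕ; NonZero; _≤_; s≤s; z≤n)
open import Data.Product using (_×_; _,_; ∃-syntax; proj₁; proj₂; swap)
open import Data.Sum using (inj₁; inj₂)
open import Data.Vec using (tabulate)
open import Data.Vec.Properties using (lookup∘tabulate; []=⇒lookup; lookup⇒[]=)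
open import Effect.Monad using (RawMonad)
open import Function.Base using (_∘_)
open import Function.Bundles using (_⇔_; mk⇔; module Equivalence)
open import Function.Construct.Composition using (_⇔-∘_)
open import Function.Construct.Symmetry using (⇔-sym)
open import Function.Related.TypeIsomorphisms using (¬-cong-⇔)
open import Relation.Binary.Construct.Closure.ReflexiveTransitive
  using (ε; _◅_; _◅◅_; map; reverse)
open import Relation.Binary.PropositionalEquality
  using (_≡_; _≢_; refl; sym; trans; module ≡-Reasoning)
open import Relation.Nullary using (¬_; does; yes; _×-dec_)
open import Relation.Nullary.Decidable
  using (dec-true; decidable-stable; ¬¬-excluded-middle)
open import Relation.Nullary.Negation using (¬¬-map; ¬¬-Monad)
open import Relation.Unary using (Pred; Decidable)

-- Subsets of a finite set cut out by predicates.

decidable⇒subset : ∀ {n ℓ} {P : Pred (Fin n) ℓ} → Decidable P →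
                   ∃[ S ] (∀ {i} → i ∈ S ⇔ P i)
decidable⇒subset {P = P} P? = S , λ {i} → mk⇔ (∈⇒P i) (P⇒∈ i)
  where
  S = tabulate (does ∘ P?)

  does⇒P : ∀ i → does (P? i) ≡ true → P i
  does⇒P i eq with yes p ← P? i = p

  ∈⇒P : ∀ i → i ∈ S → P i
  ∈⇒P i i∈S = does⇒P i (trans (sym (lookup∘tabulate _ i)) ([]=⇒lookup i∈S))

  P⇒∈ : ∀ i → P i → i ∈ S
  P⇒∈ i p = lookup⇒[]= i S (trans (lookup∘tabulate _ i) (dec-true (P? i) p))

-- Excluded middle holds under a double negation at each element; as `Fin n` is finite, `sequence`
-- moves the double negation outside the quantifier, which leaves a decision procedure for `P`.
¬¬-comprehension : ∀ {n ℓ} (P : Pred (Fin n) ℓ) →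
                   ¬ ¬ (∃[ S ] (∀ {i} → i ∈ S ⇔ P i))
¬¬-comprehension P = ¬¬-map decidable⇒subset
  (sequence (RawMonad.rawApplicative ¬¬-Monad) (λ _ → ¬¬-excluded-middle))

-- Conflict pairs within a single graph.

module _ {N t : ℕ} where

  module _ (G : EdgeColouredGraph N t) where
    open EdgeColouredGraph G

    ConflictFree : Set
    ConflictFree = ¬ (∃[ e ] ∃[ f ] ConflictPair e f)

    LongAlternatingPath : Set
    LongAlternatingPath = ∃[ P ] 2 ≤ AlternatingPath.size P

  module _ (G : EdgeColouredGraph N t) where
    open EdgeColouredGraph G

    end∈V : ∀ e {v} → v IsEndOf e → v ∈ V
    end∈V (edge a) (inj₁ refl) = proj₁ (adj-V a)
    end∈V (edge a) (inj₂ refl) = proj₂ (adj-V a)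

    walk-end∈V : ∀ {u v} → u ∈ V → Walk u v → v ∈ V
    walk-end∈V u∈V ε       = u∈V
    walk-end∈V u∈V (a ◅ w) = walk-end∈V (proj₂ (adj-V a)) w

    -- Makes a shared end the source of both edges, so that a conflict pair becomes two adjacencies
    -- out of one vertex; `ψ-cong` carries the colours along.
    orient : ∀ e {v} → v IsEndOf e → ∃[ u ] ∃[ a ] e ≈ᴱ edge {v} {u} a
    orient (edge a) (inj₁ refl) = _ , a , inj₁ (refl , refl)
    orient (edge a) (inj₂ refl) = _ , adj-sym a , inj₂ (refl , refl)

    differentColours⇒conflict : ∀ {v e f} → v IsEndOf e → v IsEndOf f →
                                ψ e ≢ ψ f → ConflictPair e f
    differentColours⇒conflict v∈e v∈f ψ≢ = (ψ≢ ∘ ψ-cong , _ , v∈e , v∈f) , ψ≢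

    -- Equality in `Fin t` is decidable, so refuting a difference of colours suffices. This also
    -- covers the case where `e` and `f` are the same undirected edge.
    conflictFree⇒sameColour : ConflictFree G → ∀ {v e f} →
                              v IsEndOf e → v IsEndOf f → ψ e ≡ ψ f
    conflictFree⇒sameColour free v∈e v∈f = decidable-stable (_ ≟ _)
      (λ ψ≢ → free (_ , _ , differentColours⇒conflict v∈e v∈f ψ≢))

    vertexMonochromatic⇔conflictFree : VertexMonochromatic ⇔ ConflictFree G
    vertexMonochromatic⇔conflictFree = mk⇔
      (λ { mono (e , f , (_ , _ , v∈e , v∈f) , ψ≢) →
             mono (end∈V e v∈e) (e , f , v∈e , v∈f , ψ≢) })
      (λ { free _ (_ , _ , v∈e , v∈f , ψ≢) →
             ψ≢ (conflictFree⇒sameColour free v∈e v∈f) })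

    -- The first two edges of the path are consecutive, hence a conflict pair.
    longAlternatingPath⇒conflict : LongAlternatingPath G →
                                   ∃[ e ] ∃[ f ] ConflictPair e f
    longAlternatingPath⇒conflict (record { walk = ε } , ())
    longAlternatingPath⇒conflict (record { walk = _ ◅ ε } , s≤s ())
    longAlternatingPath⇒conflict
      (record { walk = _ ◅ _ ◅ _ ; alternating = conflict ∷ _ } , _) =
      _ , _ , conflict

    -- The path runs `u`, `v`, `w`: it enters `v` along `a` reversed and leaves along `b`.
    twoEdgePath : ∀ {u v w} (a : Adj v u) (b : Adj v w) →
                  ψ (edge a) ≢ ψ (edge b) → LongAlternatingPath G
    twoEdgePath {u} {v} {w} a b ψ≢ = path , s≤s (s≤s z≤n)
      where
      reversed : ψ (edge (adj-sym a)) ≡ ψ (edge a)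
      reversed = ψ-cong (inj₂ (refl , refl))

      adj⇒≢ : ∀ {x y} → Adj x y → x ≢ y
      adj⇒≢ c refl = adj-irr c

      -- If the outer vertices coincided, `a` and `b` would be the same undirected edge and share a
      -- colour.
      u≢w : u ≢ w
      u≢w u≡w = ψ≢ (ψ-cong (inj₁ (refl , u≡w)))

      path : AlternatingPath
      path = record
        { start∈V     = proj₂ (adj-V a)
        ; walk        = adj-sym a ◅ b ◅ ε
        ; simple      = (adj⇒≢ (adj-sym a) ∷ u≢w ∷ []) ∷ (adj⇒≢ b ∷ []) ∷ [] ∷ []
        ; alternating =
            differentColours⇒conflict (inj₂ refl) (inj₁ refl) (ψ≢ ∘ trans (sym reversed))
            ∷ [-]
        }

    conflict⇒longAlternatingPath : ∃[ e ] ∃[ f ] ConflictPair e f →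
                                   LongAlternatingPath G
    conflict⇒longAlternatingPath (e , f , (_ , v , v∈e , v∈f) , ψ≢)
      with orient e v∈e | orient f v∈f
    ... | _ , a , e≈a | _ , b , f≈b = twoEdgePath a b
      (λ eq → ψ≢ (trans (ψ-cong e≈a) (trans eq (sym (ψ-cong f≈b)))))

    noLongAlternatingPath⇔conflictFree : (¬ LongAlternatingPath G) ⇔ ConflictFree G
    noLongAlternatingPath⇔conflictFree =
      ¬-cong-⇔ (mk⇔ longAlternatingPath⇒conflict conflict⇒longAlternatingPath)

    -- Here `e` and `f` only touch the two ends of the walk. By induction, the first edge of the
    -- walk has the colour of `e` and takes its place; at the trivial walk `e` and `f` meet.
    conflictFree⇒walkSameColour : ConflictFree G → ∀ {u v e f} → Walk u v →
                                  u IsEndOf e → v IsEndOf f → ψ e ≡ ψ f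
    conflictFree⇒walkSameColour free ε u∈e u∈f = conflictFree⇒sameColour free u∈e u∈f
    conflictFree⇒walkSameColour free (a ◅ w) u∈e v∈f = trans
      (conflictFree⇒sameColour free {f = edge a} u∈e (inj₁ refl))
      (conflictFree⇒walkSameColour free w (inj₂ refl) v∈f)

    connected⇒conflictFree⇒edgeMonochromatic :
      Connected → ConflictFree G → EdgeMonochromatic
    connected⇒conflictFree⇒edgeMonochromatic (_ , walkBetween) free (edge a) (edge b) =
      conflictFree⇒walkSameColour free
        (walkBetween (proj₁ (adj-V a)) (proj₁ (adj-V b))) (inj₁ refl) (inj₁ refl)

  -- Passing to subgraphs.

  module _ {H G : EdgeColouredGraph N t} (H⊑G : H ⊑ G) where
    private
      module H = EdgeColouredGraph H
      module G = EdgeColouredGraph G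
    open _⊑_ H⊑G

    ⊑-edge : H.Edge → G.Edge
    ⊑-edge (H.edge a) = G.edge (Adj-⊆ a)

    -- `⊑-edge` keeps both ends definitionally, so the images of `e` and `f` still meet at the same
    -- vertex of `G`.
    conflictFree-⊑ : ConflictFree G → ConflictFree H
    conflictFree-⊑ free (e , f , (_ , _ , v∈e , v∈f) , ψ≢) = ψ≢ (begin
      H.ψ e           ≡⟨ ψ-agree (H.adjacent e) ⟩
      G.ψ (⊑-edge e)  ≡⟨ conflictFree⇒sameColour G free v∈e v∈f ⟩
      G.ψ (⊑-edge f)  ≡⟨ ψ-agree (H.adjacent f) ⟨
      H.ψ f           ∎)
      where open ≡-Reasoning

  -- The component of a vertex.

  module _ (G : EdgeColouredGraph N t) {r : Fin N} {S : Subset N}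
           (r∈V : r ∈ EdgeColouredGraph.V G)
           (∈S⇔reachable : ∀ {v} → v ∈ S ⇔ EdgeColouredGraph.Walk G r v) where
    open EdgeColouredGraph G

    private
      reachable : ∀ {v} → v ∈ S → Walk r v
      reachable = Equivalence.to ∈S⇔reachable

      reached : ∀ {v} → Walk r v → v ∈ S
      reached = Equivalence.from ∈S⇔reachable

      closed : ∀ {u v} → u ∈ S → Adj u v → v ∈ S
      closed u∈S a = reached (reachable u∈S ◅◅ a ◅ ε)

    -- The reachable set `S` comes from outside, since it is available only under a double negation;
    -- once it is given, adjacency restricted to it stays decidable.
    componentAt : EdgeColouredGraph N t
    componentAt = record
      { simpleGraph = record
        { V       = S
        ; Adj     = λ u v → Adj u v × u ∈ S × v ∈ S
        ; adj?    = λ u v → adj? u v ×-dec (u ∈? S) ×-dec (v ∈? S)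
        ; adj-V   = proj₂
        ; adj-sym = λ { (a , ends∈S) → adj-sym a , swap ends∈S }
        ; adj-irr = adj-irr ∘ proj₁
        }
      ; ψ      = λ e → ψ (edge (proj₁ (SimpleGraph.adjacent e)))
      ; ψ-cong = ψ-cong
      }

    private
      module C = EdgeColouredGraph componentAt

      liftWalk : ∀ {u v} → u ∈ S → Walk u v → C.Walk u v
      liftWalk u∈S ε       = ε
      liftWalk u∈S (a ◅ w) = (a , u∈S , closed u∈S a) ◅ liftWalk (closed u∈S a) w

    componentAt-isComponent : componentAt IsComponentOf G
    componentAt-isComponent = record
      { subgraph  = record
        { V-⊆     = λ v∈S → walk-end∈V G r∈V (reachable v∈S)
        ; Adj-⊆   = proj₁
        ; ψ-agree = λ _ → refl
        }
      -- Two vertices of `S` are joined through `r`: back along one walk, out along the other.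
      ; connected = (r , reached ε) , λ u∈S v∈S →
          liftWalk u∈S (reverse adj-sym (reachable u∈S) ◅◅ reachable v∈S)
      ; maximal   = λ K K⊑G K-connected C⊑K →
          let module K = EdgeColouredGraph K
              open _⊑_ K⊑G
              -- `K` contains `r` and is connected, so a walk in `K`, read in `G`, reaches each of
              -- its vertices from `r`.
              V-⊆S : ∀ {v} → v ∈ K.V → v ∈ S
              V-⊆S v∈K =
                reached (map Adj-⊆ (proj₂ K-connected (_⊑_.V-⊆ C⊑K (reached ε)) v∈K))
          in record
            { V-⊆     = V-⊆S
            ; Adj-⊆   = λ a → Adj-⊆ a ,
                          V-⊆S (proj₁ (K.adj-V a)) , V-⊆S (proj₂ (K.adj-V a))
            ; ψ-agree = ψ-agree
            }
      }

  -- Components and conflict pairs.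

  module _ (G : EdgeColouredGraph N t) where
    open EdgeColouredGraph G

    ComponentsEdgeMonochromatic : Set₁
    ComponentsEdgeMonochromatic = ∀ H → H IsComponentOf G →
                                  EdgeColouredGraph.EdgeMonochromatic H

    conflictFree⇒componentsEdgeMonochromatic :
      ConflictFree G → ComponentsEdgeMonochromatic
    conflictFree⇒componentsEdgeMonochromatic free H H-component =
      connected⇒conflictFree⇒edgeMonochromatic H connected (conflictFree-⊑ subgraph free)
      where open _IsComponentOf_ H-component

    componentsEdgeMonochromatic⇒conflictFree :
      ComponentsEdgeMonochromatic → ConflictFree G
    componentsEdgeMonochromatic⇒conflictFree mono
      (e , f , (_ , v , v∈e , v∈f) , ψ≢) = ¬¬-comprehension (Walk v) noVertexSet
      where
      noVertexSet : ¬ (∃[ S ] (∀ {u} → u ∈ S ⇔ Walk v u))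
      noVertexSet (S , ∈S⇔reachable) with orient G e v∈e | orient G f v∈f
      ... | _ , a , e≈a | _ , b , f≈b = ψ≢ (begin
        ψ e         ≡⟨ ψ-cong e≈a ⟩
        -- Both oriented edges leave `v`, so they lie in the component of `v`, where there is only
        -- one colour.
        ψ (edge a)  ≡⟨ mono C (componentAt-isComponent G v∈V ∈S⇔reachable)
                         (C.edge (inC a)) (C.edge (inC b)) ⟩
        ψ (edge b)  ≡⟨ ψ-cong f≈b ⟨
        ψ f         ∎)
        where
        open ≡-Reasoning

        v∈V : v ∈ V
        v∈V = end∈V G e v∈e

        C : EdgeColouredGraph N t
        C = componentAt G v∈V ∈S⇔reachable

        module C = EdgeColouredGraph C

        inC : ∀ {u} → Adj v u → C.Adj v u
        inC c = c , Equivalence.from ∈S⇔reachable ε , Equivalence.from ∈S⇔reachable (c ◅ ε)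

    componentsEdgeMonochromatic⇔conflictFree :
      ComponentsEdgeMonochromatic ⇔ ConflictFree G
    componentsEdgeMonochromatic⇔conflictFree = mk⇔
      componentsEdgeMonochromatic⇒conflictFree
      conflictFree⇒componentsEdgeMonochromatic

lemma3p1 : ∀ (N t : ℕ) .{{_ : NonZero t}} (G : EdgeColouredGraph N t) →
  let open EdgeColouredGraph G
      a = VertexMonochromatic
      b = ∀ (H : EdgeColouredGraph N t) → H IsComponentOf G →
            EdgeColouredGraph.EdgeMonochromatic H
      c = ¬ (∃[ P ] 2 ≤ AlternatingPath.size P)
      d = ¬ (∃[ e ] ∃[ f ] ConflictPair e f)
  in (a ⇔ b) × (b ⇔ c) × (c ⇔ d)
lemma3p1 N t G =
    -- Statement (d) is the hub: (a), (b) and (c) are each compared with it and composed through it.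
    ⇔-sym (componentsEdgeMonochromatic⇔conflictFree G) ⇔-∘ vertexMonochromatic⇔conflictFree G
  , ⇔-sym (noLongAlternatingPath⇔conflictFree G) ⇔-∘ componentsEdgeMonochromatic⇔conflictFree G
  , noLongAlternatingPath⇔conflictFree G
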